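{- Let $\mathcal{I}$ be a ground set of $n\ge 2$ elements, $\mathcal{S}$ a family of $m$ subsets of $\mathcal{I}$ covering $\mathcal{I}$, and $\theta>1$. The degradation factor of the online set cover algorithm $\mathrm{OSC\text{ - }Alg}(\theta)$ with respect to the baseline $\mathrm{OSC\text{ - }Alg}(2)$, whose competitive ratio is $4\log n\,(2+\log m)$, is $$\mathrm{DF}(\mathrm{OSC\text{ - }Alg}(\theta))=\theta\left[\frac{2\log\theta+\log m}{2\log\theta\,(2+\log m)}\right],$$ i.e. $\mathrm{OSC\text{ - }Alg}(\theta)$ has competitive ratio $$\mathrm{DF}(\mathrm{OSC\text{ - }Alg}(\theta))\cdot 4\log n\,(2+\log m)=(2\theta\log n)\left(2+\frac{\log m}{\log\theta}\right):$$ for every sequence of arriving elements, the number of sets it selects is at most this quantity times the minimum number of sets of $\mathcal{S}$ needed to cover the arrived elements.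
   Context: All logarithms are to base $2$. Online (unweighted) set cover: $\mathcal{I}$ and $\mathcal{S}$ are known in advance. The elements of an unknown subset $\mathcal{I}'\subseteq\mathcal{I}$ arrive one by one. When an element arrives it must be covered by the sets selected so far, where selections are irrevocable. The goal is to minimize the number of selected sets. The offline optimum is the minimum number of sets in $\mathcal{S}$ covering $\mathcal{I}'$. For $i\in\mathcal{I}$ let $\mathcal{S}_i=\{s\in\mathcal{S}: i\in s\}$. The algorithm maintains set weights $w_s$, and element weights $w_i=\sum_{s\in\mathcal{S}_i}w_s$. It also maintains the collection $\mathcal{S}^{\mathrm{sel}}$ of selected sets, the set $\mathcal{I}^{\mathrm{sel}}$ of covered elements (those belonging to some selected set), and the potential $\Phi=\sum_{i\notin\mathcal{I}^{\mathrm{sel}}}n^{2w_i}$. $\mathrm{OSC\text{ - }Alg}(\theta)$, $\theta>1$: initialize $w_s=\frac{1}{\theta m}$ for all $s\in\mathcal{S}$ and $\mathcal{I}^{\mathrm{sel}}=\mathcal{S}^{\mathrm{sel}}=\emptyset$. When element $i$ arrives: - if $w_i\ge1$, i.e. $i$ is already covered ($i\in\mathcal{I}^{\mathrm{sel}}$), do nothing; - otherwise (a) find the minimum $k$ such that $\theta^k w_i>1$; (b) update $w_s\leftarrow\theta^k w_s$ for all $s\in\mathcal{S}_i$; (c) select at most $2\theta\log n$ sets from $\mathcal{S}_i$ such that, after adding them to $\mathcal{S}^{\mathrm{sel}}$ (with the updated weights), the potential $\Phi$ is not larger than it was before this step, and add $i$ to $\mathcal{I}^{\mathrm{sel}}$.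 For $\theta=2$ this is the known algorithm, with competitive ratio $4\log n\,(2+\log m)$. The degradation factor $\mathrm{DF}(A(\theta))$ relative to a baseline $A(\theta_0)$ is a factor with $\mathrm{CR}(A(\theta))\le\mathrm{DF}(A(\theta))\,\mathrm{CR}(A(\theta_0))$. -}

module Defs where

open import Level using (Level; _⊔_; suc)
open import Algebra.Bundles using (CommutativeRing; Semiring)
import Algebra.Definitions.RawMonoid as RawMonoidOps
import Algebra.Definitions.RawSemiring as RawSemiringOps
open import Data.Bool.Base using (if_then_else_)
open import Data.Fin.Base using (Fin)
open import Data.Fin.Properties using (any?)
open import Data.Fin.Subset using (Subset; _∈_; _∪_; ∣_∣) renaming (⊥ to ∅)
open import Data.Fin.Subset.Properties using (_∈?_)
open import Data.List.Base using (List; []; _∷_)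
import Data.List.Membership.Propositional as List
open import Data.Nat.Base as ℕ using (ℕ)
open import Data.Product.Base using (∃; ∃₂; _×_; _,_)
open import Data.Sum.Base using (_⊎_)
open import Relation.Binary.Core using (Rel)
import Relation.Binary.Construct.NonStrictToStrict as ToStrict
open import Relation.Binary.PropositionalEquality.Core using (_≡_)
open import Relation.Binary.Structures using (IsDecTotalOrder)
open import Relation.Nullary.Decidable using (does; _×-dec_)
open import Relation.Unary using (Pred; Decidable)
open import Relation.Unary.Properties using (∁?)

-- The real numbers, given by their classical characterisation: a (non-trivial)
-- totally ordered field in which every inhabited predicate that is bounded
-- above has a least upper bound.  Any two such fields are isomorphic.  As usual
-- for total inverse and supremum functions, `0# ⁻¹` and `sup` of an empty or
-- unbounded predicate are unspecified.
record CompleteOrderedField (c ℓ : Level) : Set (suc (c ⊔ ℓ)) where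
  infix  4 _≤_
  infix  8 _⁻¹
  field
    commutativeRing : CommutativeRing c ℓ
  open CommutativeRing commutativeRing public
  field
    _≤_             : Rel Carrier ℓ
    isDecTotalOrder : IsDecTotalOrder _≈_ _≤_
    +-monoˡ-≤       : ∀ z {x y} → x ≤ y → x + z ≤ y + z
    *-nonneg        : ∀ {x y} → 0# ≤ x → 0# ≤ y → 0# ≤ x * y
    0≉1             : 0# ≉ 1#
    _⁻¹             : Carrier → Carrier
    ⁻¹-inverseʳ     : ∀ {x} → x ≉ 0# → x * x ⁻¹ ≈ 1#

  UpperBound : Pred Carrier ℓ → Pred Carrier (c ⊔ ℓ)
  UpperBound P u = ∀ {x} → P x → x ≤ u

  IsLeastUpperBound : Pred Carrier ℓ → Pred Carrier (c ⊔ ℓ)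
  IsLeastUpperBound P u = UpperBound P u × (∀ {v} → UpperBound P v → u ≤ v)

  field
    sup       : Pred Carrier ℓ → Carrier
    sup-isLUB : ∀ P → ∃ P → ∃ (UpperBound P) → IsLeastUpperBound P (sup P)

  open ToStrict _≈_ _≤_ public using (_<_)
  open RawSemiringOps (Semiring.rawSemiring semiring) public using (_^_)
  open RawMonoidOps +-rawMonoid public using (sum) renaming (_×_ to _·_)

  fromℕ : ℕ → Carrier
  fromℕ n = n · 1#

  2# : Carrier
  2# = fromℕ 2

  4# : Carrier
  4# = fromℕ 4

  -- For 1 ≤ x: the supremum of the rationals a/b ≥ 0 (with b = 1 + b′)
  -- such that 2^(a/b) ≤ x.
  log : Carrier → Carrier
  log x = sup λ r → ∃₂ λ a b′ →
    (r * fromℕ (ℕ.suc b′) ≈ fromℕ a) × (2# ^ a ≤ x ^ ℕ.suc b′)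

  infixr 8 _^ᴿ_

  -- For 1 ≤ x and 0 ≤ y: the supremum of the r ≥ 0 such that r ≤ x^(a/b) for
  -- some rational 0 ≤ a/b ≤ y (with b = 1 + b′).
  _^ᴿ_ : Carrier → Carrier → Carrier
  x ^ᴿ y = sup λ r → (0# ≤ r) × ∃₂ λ a b′ →
    (fromℕ a ≤ y * fromℕ (ℕ.suc b′)) × (r ^ ℕ.suc b′ ≤ x ^ a)

  sumOver : ∀ {k p} {P : Pred (Fin k) p} → Decidable P → (Fin k → Carrier) → Carrier
  sumOver P? f = sum λ j → if does (P? j) then f j else 0#

-- Set cover with ground set `Fin n` and the family of sets `S 0, …, S (m-1)`;
-- a subcollection of the family is a subset of the index set `Fin m`.
module SetCover {n m : ℕ} (S : Fin m → Subset n) where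

  Covered : Subset m → Pred (Fin n) _
  Covered C i = ∃ λ s → s ∈ C × i ∈ S s

  covered? : ∀ C → Decidable (Covered C)
  covered? C i = any? λ s → (s ∈? C) ×-dec (i ∈? S s)

  CoversAll : Subset m → List (Fin n) → Set
  CoversAll C σ = ∀ {i} → i List.∈ σ → Covered C i

  IsOptimum : List (Fin n) → ℕ → Set
  IsOptimum σ k = (∃ λ C → CoversAll C σ × ∣ C ∣ ≡ k)
                × (∀ C → CoversAll C σ → k ℕ.≤ ∣ C ∣)

module OnlineSetCover {c ℓ} (ℝ : CompleteOrderedField c ℓ)
                      {n m : ℕ} (S : Fin m → Subset n) where
  open CompleteOrderedField ℝ
  open SetCover S

  -- An online algorithm with unspecified choices, as the relation between an
  -- arrival sequence and the possible final collections of selected sets.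
  Algorithm : Set _
  Algorithm = List (Fin n) → Subset m → Set (c ⊔ ℓ)

  -- ρ is an upper bound on the ratio to the offline optimum, whatever choices
  -- the algorithm makes.
  HasCompetitiveRatio : Algorithm → Carrier → Set (c ⊔ ℓ)
  HasCompetitiveRatio A ρ = ∀ σ C opt → A σ C → IsOptimum σ opt →
    fromℕ ∣ C ∣ ≤ ρ * fromℕ opt

  -- δ is a degradation factor of A relative to the baseline A₀, whose
  -- competitive ratio is ρ₀.
  IsDegradationFactor : Carrier → Algorithm → Algorithm → Carrier → Set (c ⊔ ℓ)
  IsDegradationFactor δ A A₀ ρ₀ =
    HasCompetitiveRatio A₀ ρ₀ × HasCompetitiveRatio A (δ * ρ₀)

  record State : Set c where
    constructor ⟨_,_⟩
    field
      weight   : Fin m → Carrier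
      selected : Subset m

  elementWeight : (Fin m → Carrier) → Fin n → Carrier
  elementWeight w i = sumOver (λ s → i ∈? S s) w

  potential : State → Carrier
  potential ⟨ w , C ⟩ =
    sumOver (∁? (covered? C)) λ i → fromℕ n ^ᴿ (2# * elementWeight w i)

  initial : Carrier → State
  initial θ = ⟨ (λ _ → (θ * fromℕ m) ⁻¹) , ∅ ⟩

  augment : Carrier → ℕ → Fin n → (Fin m → Carrier) → (Fin m → Carrier)
  augment θ k i w s = if does (i ∈? S s) then θ ^ k * w s else w s

  -- The test of the algorithm treats "wᵢ ≥ 1" and "i is already covered" as
  -- interchangeable, which they need not be: nothing is done if either holds,
  -- while the update is possible whenever wᵢ < 1.  Hence an element that is
  -- covered but has wᵢ < 1 may be handled either way.
  data Step (θ : Carrier) : State → Fin n → State → Set (c ⊔ ℓ) where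
    skip : ∀ {w C i} →
      (1# ≤ elementWeight w i) ⊎ Covered C i →
      Step θ ⟨ w , C ⟩ i ⟨ w , C ⟩
    update : ∀ {w C i} (k : ℕ) (T : Subset m) →
      elementWeight w i < 1# →
      1# < θ ^ k * elementWeight w i →
      (∀ j → 1# < θ ^ j * elementWeight w i → k ℕ.≤ j) →
      (∀ {s} → s ∈ T → i ∈ S s) →
      fromℕ ∣ T ∣ ≤ 2# * θ * log (fromℕ n) →
      Covered (C ∪ T) i →
      potential ⟨ augment θ k i w , C ∪ T ⟩ ≤ potential ⟨ w , C ⟩ →
      Step θ ⟨ w , C ⟩ i ⟨ augment θ k i w , C ∪ T ⟩

  data Run (θ : Carrier) : State → List (Fin n) → State → Set (c ⊔ ℓ) where
    []  : ∀ {st} → Run θ st [] st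
    _∷_ : ∀ {st st′ st″ i σ} →
      Step θ st i st′ → Run θ st′ σ st″ → Run θ st (i ∷ σ) st″

  OSC-Alg : Carrier → Algorithm
  OSC-Alg θ σ C = ∃ λ w → Run θ (initial θ) σ ⟨ w , C ⟩

  baselineRatio : Carrier
  baselineRatio = 4# * log (fromℕ n) * (2# + log (fromℕ m))

  DF : Carrier → Carrier
  DF θ = θ * ((2# * log θ + log (fromℕ m))
              * (2# * log θ * (2# + log (fromℕ m))) ⁻¹)

{-# OPTIONS --safe #-}

-- Fix an optimal cover D.  An update on i happens when w_i < 1, and minimality
-- of k gives θ^k w_i ≤ θ, so every weight stays at most θ.  A set that took part
-- in N updates has weight at least θ^N / (θ m), whence θ^N ≤ θ² m and
-- N ≤ 2 + log m / log θ.  Every update touches some set of D and costs at most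
-- 2 θ log n, so the total cost is at most 2 θ log n · |D| · (2 + log m / log θ).
module Submission where

open import Defs
open import Data.Nat.Base as ℕ using (ℕ)
open import Data.Fin.Base using (Fin; zero; suc; fromℕ<)
open import Data.Fin.Subset using (Subset; _∈_; inside; outside; _∪_; ∣_∣)
open import Data.Product.Base using (∃; ∃₂; _×_; _,_; proj₁; proj₂)

import Algebra.Properties.Monoid.Mult as MonoidMult
import Algebra.Properties.Monoid.Sum as MonoidSum
import Algebra.Properties.Ring as RingProperties
import Algebra.Properties.Semiring.Exp as SemiringExp
import Algebra.Properties.Semiring.Mult as SemiringMult
import Algebra.Solver.Ring.NaturalCoefficients.Default as NaturalCoefficients
open import Data.Bool.Base using (true; false; if_then_else_)
import Data.Fin.Properties as Fin
open import Data.Fin.Subset.Properties using (_∈?_; ∣⊥∣≡0)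
open import Data.List.Base using ([]; _∷_)
open import Data.List.Relation.Unary.Any using (here; there)
import Data.Nat.DivMod as ℕ
import Data.Nat.Properties as ℕ
open import Data.Sum.Base using (inj₁; inj₂)
open import Data.Vec.Base using ([]; _∷_)
open import Function.Base using (_∘_)
open import Level using (_⊔_)
open import Relation.Binary.Bundles using (DecTotalOrder)
import Relation.Binary.PropositionalEquality.Core as ≡
import Relation.Binary.Reasoning.PartialOrder as PosetReasoning
open import Relation.Binary.Structures using (IsDecTotalOrder)
open import Relation.Nullary.Decidable using (does; yes; no)
open import Relation.Nullary.Negation using (¬_; contradiction)
open import Relation.Unary using (Pred; Decidable)

-- Size of a union of finite subsets

∣p∪q∣≤∣p∣+∣q∣ : ∀ {n} (p q : Subset n) → ∣ p ∪ q ∣ ℕ.≤ ∣ p ∣ ℕ.+ ∣ q ∣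
∣p∪q∣≤∣p∣+∣q∣ []            []            = ℕ.z≤n
∣p∪q∣≤∣p∣+∣q∣ (outside ∷ p) (outside ∷ q) = ∣p∪q∣≤∣p∣+∣q∣ p q
∣p∪q∣≤∣p∣+∣q∣ (outside ∷ p) (inside ∷ q)  =
  ℕ.≤-trans (ℕ.s≤s (∣p∪q∣≤∣p∣+∣q∣ p q)) (ℕ.≤-reflexive (≡.sym (ℕ.+-suc ∣ p ∣ ∣ q ∣)))
∣p∪q∣≤∣p∣+∣q∣ (inside ∷ p)  (outside ∷ q) = ℕ.s≤s (∣p∪q∣≤∣p∣+∣q∣ p q)
∣p∪q∣≤∣p∣+∣q∣ (inside ∷ p)  (inside ∷ q)  =
  ℕ.s≤s (ℕ.≤-trans (∣p∪q∣≤∣p∣+∣q∣ p q) (ℕ.+-monoʳ-≤ ∣ p ∣ (ℕ.n≤1+n ∣ q ∣)))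

module OrderedFieldProperties {c ℓ} (ℝ : CompleteOrderedField c ℓ) where
  open CompleteOrderedField ℝ hiding (zero)
  open IsDecTotalOrder isDecTotalOrder public
    using (_≤?_; total; antisym; ≤-respˡ-≈; ≤-respʳ-≈)
    renaming (refl to ≤-refl; reflexive to ≤-reflexive; trans to ≤-trans)
  open RingProperties ring public using (-1*x≈-x; -‿involutive)
  open MonoidMult +-monoid public using (×-homo-+)
  open SemiringMult semiring public using (×1-homo-*)
  open SemiringExp semiring public using (^-congʳ; ^-assocʳ)
  open MonoidSum +-monoid public using (sum-replicate-zero)

  decTotalOrder : DecTotalOrder c ℓ ℓ
  decTotalOrder = record { isDecTotalOrder = isDecTotalOrder }

  module ≤-Reasoning = PosetReasoning (DecTotalOrder.poset decTotalOrder)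
  module Solver = NaturalCoefficients commutativeSemiring
  open ≤-Reasoning

  -- Arithmetic of ordered fields

  ≰⇒≥ : ∀ {x y} → ¬ (x ≤ y) → y ≤ x
  ≰⇒≥ {x} {y} x≰y with total x y
  ... | inj₁ x≤y = contradiction x≤y x≰y
  ... | inj₂ y≤x = y≤x

  +-monoʳ-≤ : ∀ z {x y} → x ≤ y → z + x ≤ z + y
  +-monoʳ-≤ z {x} {y} x≤y = begin
    z + x  ≈⟨ +-comm z x ⟩
    x + z  ≤⟨ +-monoˡ-≤ z x≤y ⟩
    y + z  ≈⟨ +-comm y z ⟩
    z + y  ∎

  +-mono-≤ : ∀ {x y u v} → x ≤ y → u ≤ v → x + u ≤ y + v
  +-mono-≤ {y = y} {u} x≤y u≤v = ≤-trans (+-monoˡ-≤ u x≤y) (+-monoʳ-≤ y u≤v)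

  +-nonneg : ∀ {x y} → 0# ≤ x → 0# ≤ y → 0# ≤ x + y
  +-nonneg 0≤x 0≤y = ≤-respˡ-≈ (+-identityˡ 0#) (+-mono-≤ 0≤x 0≤y)

  [x-y]+y≈x : ∀ x y → (x - y) + y ≈ x
  [x-y]+y≈x x y = trans (+-assoc x (- y) y) (trans (+-congˡ (-‿inverseˡ y)) (+-identityʳ x))

  [x+y]-y≈x : ∀ x y → (x + y) - y ≈ x
  [x+y]-y≈x x y = trans (+-assoc x y (- y)) (trans (+-congˡ (-‿inverseʳ y)) (+-identityʳ x))

  x≤y⇒0≤y-x : ∀ {x y} → x ≤ y → 0# ≤ y - x
  x≤y⇒0≤y-x {x} x≤y = ≤-respˡ-≈ (-‿inverseʳ x) (+-monoˡ-≤ (- x) x≤y)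

  +-cancelʳ-≤ : ∀ z {x y} → x + z ≤ y + z → x ≤ y
  +-cancelʳ-≤ z {x} {y} x+z≤y+z = begin
    x            ≈⟨ [x+y]-y≈x x z ⟨
    (x + z) - z  ≤⟨ +-monoˡ-≤ (- z) x+z≤y+z ⟩
    (y + z) - z  ≈⟨ [x+y]-y≈x y z ⟩
    y            ∎

  -- The product axiom concerns nonnegative factors only, so it is applied to `z` and `y - x`, and
  -- `z * x` is then added to both sides.
  *-monoʳ-≤ : ∀ {z x y} → 0# ≤ z → x ≤ y → z * x ≤ z * y
  *-monoʳ-≤ {z} {x} {y} 0≤z x≤y = begin
    z * x                ≈⟨ +-identityˡ (z * x) ⟨
    0# + z * x           ≤⟨ +-monoˡ-≤ (z * x) (*-nonneg 0≤z (x≤y⇒0≤y-x x≤y)) ⟩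
    z * (y - x) + z * x  ≈⟨ distribˡ z (y - x) x ⟨
    z * ((y - x) + x)    ≈⟨ *-congˡ ([x-y]+y≈x y x) ⟩
    z * y                ∎

  *-monoˡ-≤ : ∀ {z x y} → 0# ≤ z → x ≤ y → x * z ≤ y * z
  *-monoˡ-≤ {z} {x} {y} 0≤z x≤y = begin
    x * z  ≈⟨ *-comm x z ⟩
    z * x  ≤⟨ *-monoʳ-≤ 0≤z x≤y ⟩
    z * y  ≈⟨ *-comm z y ⟩
    y * z  ∎

  *-mono-≤ : ∀ {x y u v} → 0# ≤ y → 0# ≤ u → x ≤ y → u ≤ v → x * u ≤ y * v
  *-mono-≤ 0≤y 0≤u x≤y u≤v = ≤-trans (*-monoˡ-≤ 0≤u x≤y) (*-monoʳ-≤ 0≤y u≤v)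

  -- By totality the only other case is `1# ≤ 0#`. Then `- 1#` is nonnegative, and so is its square,
  -- which is 1.
  0≤1 : 0# ≤ 1#
  0≤1 with total 0# 1#
  ... | inj₁ 0≤1 = 0≤1
  ... | inj₂ 1≤0 = begin
    0#           ≤⟨ *-nonneg 0≤-1 0≤-1 ⟩
    - 1# * - 1#  ≈⟨ -1*x≈-x (- 1#) ⟩
    - - 1#       ≈⟨ -‿involutive 1# ⟩
    1#           ∎
    where
    0≤-1 : 0# ≤ - 1#
    0≤-1 = ≤-respʳ-≈ (+-identityˡ (- 1#)) (x≤y⇒0≤y-x 1≤0)

  0<1≤x : ∀ {x} → 1# ≤ x → 0# < x
  0<1≤x 1≤x = begin-strict
    0#  <⟨ 0≤1 , 0≉1 ⟩
    1#  ≤⟨ 1≤x ⟩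
    _   ∎

  x≤1+x : ∀ x → x ≤ 1# + x
  x≤1+x x = ≤-respˡ-≈ (+-identityˡ x) (+-monoˡ-≤ x 0≤1)

  ⁻¹-inverseˡ : ∀ {x} → x ≉ 0# → x ⁻¹ * x ≈ 1#
  ⁻¹-inverseˡ {x} x≉0 = trans (*-comm (x ⁻¹) x) (⁻¹-inverseʳ x≉0)

  *-cancelˡ-≈ : ∀ {z x y} → z ≉ 0# → z * x ≈ z * y → x ≈ y
  *-cancelˡ-≈ {z} {x} {y} z≉0 zx≈zy = trans (sym (z⁻¹[zt]≈t x)) (trans (*-congˡ zx≈zy) (z⁻¹[zt]≈t y))
    where
    z⁻¹[zt]≈t : ∀ t → z ⁻¹ * (z * t) ≈ t
    z⁻¹[zt]≈t t = trans (sym (*-assoc (z ⁻¹) z t)) (trans (*-congʳ (⁻¹-inverseˡ z≉0)) (*-identityˡ t))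

  -- By totality only `y ≤ x` needs work: multiplying it by `z` gives the reverse of the hypothesis,
  -- so the two products agree and the nonzero factor cancels.
  *-cancelˡ-≤ : ∀ {z x y} → 0# < z → z * x ≤ z * y → x ≤ y
  *-cancelˡ-≤ {z} {x} {y} (0≤z , 0≉z) zx≤zy with total x y
  ... | inj₁ x≤y = x≤y
  ... | inj₂ y≤x = ≤-reflexive (*-cancelˡ-≈ (0≉z ∘ sym) (antisym zx≤zy (*-monoʳ-≤ 0≤z y≤x)))

  *-cancelʳ-≤ : ∀ {z x y} → 0# < z → x * z ≤ y * z → x ≤ y
  *-cancelʳ-≤ {z} {x} {y} 0<z xz≤yz =
    *-cancelˡ-≤ 0<z (≤-respˡ-≈ (*-comm x z) (≤-respʳ-≈ (*-comm y z) xz≤yz))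

  -- After multiplication by the positive `x` the claim becomes `0# ≤ 1#`.
  ⁻¹-nonneg : ∀ {x} → 0# < x → 0# ≤ x ⁻¹
  ⁻¹-nonneg {x} 0<x@(_ , 0≉x) = *-cancelˡ-≤ 0<x (begin
    x * 0#    ≈⟨ zeroʳ x ⟩
    0#        ≤⟨ 0≤1 ⟩
    1#        ≈⟨ ⁻¹-inverseʳ (0≉x ∘ sym) ⟨
    x * x ⁻¹  ∎)

  *-positive : ∀ {x y} → 0# < x → 0# < y → 0# < x * y
  *-positive {x} {y} (0≤x , 0≉x) (0≤y , 0≉y) =
    *-nonneg 0≤x 0≤y ,
    λ 0≈xy → 0≉y (*-cancelˡ-≈ (0≉x ∘ sym) (trans (zeroʳ x) 0≈xy))

  -- Natural numbers and powers in the field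

  fromℕ-nonneg : ∀ n → 0# ≤ fromℕ n
  fromℕ-nonneg ℕ.zero    = ≤-refl
  fromℕ-nonneg (ℕ.suc n) = +-nonneg 0≤1 (fromℕ-nonneg n)

  fromℕ-mono-≤ : ∀ {m n} → m ℕ.≤ n → fromℕ m ≤ fromℕ n
  fromℕ-mono-≤ {n = n} ℕ.z≤n = fromℕ-nonneg n
  fromℕ-mono-≤ (ℕ.s≤s m≤n)   = +-monoʳ-≤ 1# (fromℕ-mono-≤ m≤n)

  1≤fromℕ : ∀ {n} → 1 ℕ.≤ n → 1# ≤ fromℕ n
  1≤fromℕ 1≤n = ≤-respˡ-≈ (+-identityʳ 1#) (fromℕ-mono-≤ {1} 1≤n)

  1≤2 : 1# ≤ 2#
  1≤2 = 1≤fromℕ {2} (ℕ.s≤s ℕ.z≤n)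

  0<fromℕ[1+n] : ∀ n → 0# < fromℕ (ℕ.suc n)
  0<fromℕ[1+n] n = 0<1≤x (1≤fromℕ {ℕ.suc n} (ℕ.s≤s ℕ.z≤n))

  ^-nonneg : ∀ {x} n → 0# ≤ x → 0# ≤ x ^ n
  ^-nonneg ℕ.zero    0≤x = 0≤1
  ^-nonneg (ℕ.suc n) 0≤x = *-nonneg 0≤x (^-nonneg n 0≤x)

  ^-monoˡ-≤ : ∀ {x y} n → 0# ≤ x → x ≤ y → x ^ n ≤ y ^ n
  ^-monoˡ-≤ ℕ.zero    0≤x x≤y = ≤-refl
  ^-monoˡ-≤ (ℕ.suc n) 0≤x x≤y =
    *-mono-≤ (≤-trans 0≤x x≤y) (^-nonneg n 0≤x) x≤y (^-monoˡ-≤ n 0≤x x≤y)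

  1≤x^n : ∀ {x} n → 1# ≤ x → 1# ≤ x ^ n
  1≤x^n     ℕ.zero    1≤x = ≤-refl
  1≤x^n {x} (ℕ.suc n) 1≤x = begin
    1#         ≈⟨ *-identityˡ 1# ⟨
    1# * 1#    ≤⟨ *-mono-≤ (≤-trans 0≤1 1≤x) 0≤1 1≤x (1≤x^n n 1≤x) ⟩
    x * x ^ n  ∎

  ^-monoʳ-≤ : ∀ {x m n} → 1# ≤ x → m ℕ.≤ n → x ^ m ≤ x ^ n
  ^-monoʳ-≤ {n = n} 1≤x ℕ.z≤n       = 1≤x^n n 1≤x
  ^-monoʳ-≤         1≤x (ℕ.s≤s m≤n) = *-monoʳ-≤ (≤-trans 0≤1 1≤x) (^-monoʳ-≤ 1≤x m≤n)

  -- When `x ≤ y`, one factor `y` of the left power may be lowered to `x`. Both sides then carry a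
  -- factor `x`, which cancels, and the exponent descends until it is 1.
  ^-cancelˡ-≤ : ∀ {x y} n → 0# < x → y ^ ℕ.suc n ≤ x ^ ℕ.suc n → y ≤ x
  ^-cancelˡ-≤ {x} {y} n 0<x@(0≤x , _) yⁿ≤xⁿ with total y x
  ... | inj₁ y≤x = y≤x
  ... | inj₂ x≤y = go n yⁿ≤xⁿ
    where
    go : ∀ n → y ^ ℕ.suc n ≤ x ^ ℕ.suc n → y ≤ x
    go ℕ.zero    y≤x = ≤-respˡ-≈ (*-identityʳ y) (≤-respʳ-≈ (*-identityʳ x) y≤x)
    go (ℕ.suc n) yyⁿ≤xxⁿ = go n (*-cancelˡ-≤ 0<x
      (≤-trans (*-monoˡ-≤ (^-nonneg (ℕ.suc n) (≤-trans 0≤x x≤y)) x≤y) yyⁿ≤xxⁿ))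

  -- This crude bound is what keeps the rationals defining `log` bounded. In the induction the extra
  -- 1 is absorbed by a second copy of `2# ^ n`.
  fromℕ-n≤2^n : ∀ n → fromℕ n ≤ 2# ^ n
  fromℕ-n≤2^n ℕ.zero    = 0≤1
  fromℕ-n≤2^n (ℕ.suc n) = begin
    1# + fromℕ n                       ≤⟨ +-mono-≤ (1≤x^n n 1≤2) (fromℕ-n≤2^n n) ⟩
    2# ^ n + 2# ^ n                    ≈⟨ solve 1 (λ t → t :+ t := (con 1 :+ (con 1 :+ con 0)) :* t) refl (2# ^ n) ⟩
    2# * 2# ^ n                        ∎
    where open Solver

  -- An Archimedean argument from completeness. If the powers had a supremum `L`, then with
  -- `d = x - 1#` each power plus `d` is at most the next power, hence at most `L`. So `L - d`
  -- bounds all powers too, which forces `d` to be at most 0.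
  x^n-unbounded : ∀ {x} → 1# < x → ∀ u → ¬ (∀ n → x ^ n ≤ u)
  x^n-unbounded {x} (1≤x , 1≉x) u xⁿ≤u = 1≉x (antisym 1≤x x≤1)
    where
    Power : Pred Carrier ℓ
    Power r = ∃ λ n → r ≈ x ^ n

    L : Carrier
    L = sup Power

    isLUB : IsLeastUpperBound Power L
    isLUB = sup-isLUB Power (1# , 0 , refl) (u , λ (n , r≈xⁿ) → ≤-respˡ-≈ (sym r≈xⁿ) (xⁿ≤u n))

    d : Carrier
    d = x - 1#

    xⁿ+d≤L : ∀ n → x ^ n + d ≤ L
    xⁿ+d≤L n = begin
      x ^ n + d           ≈⟨ +-congˡ (*-identityʳ d) ⟨
      x ^ n + d * 1#      ≤⟨ +-monoʳ-≤ (x ^ n) (*-monoʳ-≤ (x≤y⇒0≤y-x 1≤x) (1≤x^n n 1≤x)) ⟩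
      x ^ n + d * x ^ n   ≈⟨ solve 2 (λ t d → t :+ d :* t := (d :+ con 1) :* t) refl (x ^ n) d ⟩
      (d + 1#) * x ^ n    ≈⟨ *-congʳ ([x-y]+y≈x x 1#) ⟩
      x ^ ℕ.suc n         ≤⟨ proj₁ isLUB (ℕ.suc n , refl) ⟩
      L                   ∎
      where open Solver

    L≤L-d : L ≤ L - d
    L≤L-d = proj₂ isLUB λ {r} (n , r≈xⁿ) → +-cancelʳ-≤ d (begin
      r + d        ≈⟨ +-congʳ r≈xⁿ ⟩
      x ^ n + d    ≤⟨ xⁿ+d≤L n ⟩
      L            ≈⟨ [x-y]+y≈x L d ⟨
      (L - d) + d  ∎)

    x≤1 : x ≤ 1#
    x≤1 = +-cancelʳ-≤ L (begin
      x + L               ≤⟨ +-monoʳ-≤ x L≤L-d ⟩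
      x + (L - d)         ≈⟨ +-congʳ ([x-y]+y≈x x 1#) ⟨
      (d + 1#) + (L - d)  ≈⟨ solve 3 (λ d e L → (d :+ e) :+ L := e :+ (L :+ d)) refl d 1# (L - d) ⟩
      1# + ((L - d) + d)  ≈⟨ +-congˡ ([x-y]+y≈x L d) ⟩
      1# + L              ∎)
      where open Solver

  -- The logarithm as a supremum of rationals

  log-set : Carrier → Pred Carrier ℓ
  log-set x r = ∃₂ λ a b′ →
    (r * fromℕ (ℕ.suc b′) ≈ fromℕ a) × (2# ^ a ≤ x ^ ℕ.suc b′)

  -- With q = ⌊a/b⌋, 2^a ≤ x^b yields q ≤ 2^q ≤ x.
  log-set-bounded : ∀ {x} → 1# ≤ x → UpperBound (log-set x) (1# + x)
  log-set-bounded {x} 1≤x {r} (a , b′ , rb≈a , 2^a≤x^b) = *-cancelʳ-≤ (0<fromℕ[1+n] b′) (begin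
    r * fromℕ b                ≈⟨ rb≈a ⟩
    fromℕ a                    ≤⟨ fromℕ-mono-≤ a≤[1+q]b ⟩
    fromℕ (ℕ.suc q ℕ.* b)      ≈⟨ ×1-homo-* (ℕ.suc q) b ⟩
    fromℕ (ℕ.suc q) * fromℕ b  ≤⟨ *-monoˡ-≤ (fromℕ-nonneg b) (+-monoʳ-≤ 1# (≤-trans (fromℕ-n≤2^n q) 2^q≤x)) ⟩
    (1# + x) * fromℕ b         ∎)
    where
    b q : ℕ
    b = ℕ.suc b′
    q = a ℕ./ b

    a≤[1+q]b : a ℕ.≤ ℕ.suc q ℕ.* b
    a≤[1+q]b = ℕ.≤-trans (ℕ.≤-reflexive (ℕ.m≡m%n+[m/n]*n a b))
      (ℕ.+-monoˡ-≤ (q ℕ.* b) (ℕ.<⇒≤ (ℕ.m%n<n a b)))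

    2^q≤x : 2# ^ q ≤ x
    2^q≤x = ^-cancelˡ-≤ b′ (0<1≤x 1≤x) (begin
      (2# ^ q) ^ b    ≈⟨ ^-assocʳ 2# q b ⟩
      2# ^ (q ℕ.* b)  ≤⟨ ^-monoʳ-≤ 1≤2 (ℕ.m/n*n≤m a b) ⟩
      2# ^ a          ≤⟨ 2^a≤x^b ⟩
      x ^ b           ∎)

  log-isLUB : ∀ {x} → 1# ≤ x → IsLeastUpperBound (log-set x) (log x)
  log-isLUB {x} 1≤x = sup-isLUB (log-set x)
    -- The predicate is inhabited by the rational 0/1; the second 0 is `b′`, so the denominator is
    -- 1.
    (0# , 0 , 0 , zeroˡ (fromℕ 1) , 1≤x^n 1 1≤x)
    (1# + x , log-set-bounded 1≤x)

  log-nonneg : ∀ {x} → 1# ≤ x → 0# ≤ log x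
  log-nonneg 1≤x = proj₁ (log-isLUB 1≤x) (0 , 0 , zeroˡ (fromℕ 1) , 1≤x^n 1 1≤x)

  -- If the logarithm were 0, no reciprocal of a positive integer `b` could lie below it, so
  -- `2# ≤ x ^ b` would fail for every such `b`. All powers of `x` would then be at most 2, against
  -- their unboundedness.
  log-positive : ∀ {x} → 1# < x → 0# < log x
  log-positive {x} 1<x@(1≤x , _) = log-nonneg 1≤x , λ 0≈log → x^n-unbounded 1<x 2# (xⁿ≤2 0≈log)
    where
    [1+b]⁻¹[1+b]≈1 : ∀ b → fromℕ (ℕ.suc b) ⁻¹ * fromℕ (ℕ.suc b) ≈ 1#
    [1+b]⁻¹[1+b]≈1 b = ⁻¹-inverseˡ (proj₂ (0<fromℕ[1+n] b) ∘ sym)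

    2≤xᵇ⇒b⁻¹≤log : ∀ b → 2# ≤ x ^ ℕ.suc b → fromℕ (ℕ.suc b) ⁻¹ ≤ log x
    2≤xᵇ⇒b⁻¹≤log b 2≤xᵇ = proj₁ (log-isLUB 1≤x)
      (1 , b , trans ([1+b]⁻¹[1+b]≈1 b) (sym (+-identityʳ 1#)) , ≤-respˡ-≈ (sym (*-identityʳ 2#)) 2≤xᵇ)

    xⁿ≤2 : 0# ≈ log x → ∀ n → x ^ n ≤ 2#
    xⁿ≤2 0≈log ℕ.zero    = 1≤2
    xⁿ≤2 0≈log (ℕ.suc b) = ≰⇒≥ λ 2≤xᵇ → 0≉1 (antisym 0≤1 (begin
      1#                                    ≈⟨ [1+b]⁻¹[1+b]≈1 b ⟨
      fromℕ (ℕ.suc b) ⁻¹ * fromℕ (ℕ.suc b)  ≤⟨ *-monoˡ-≤ (fromℕ-nonneg (ℕ.suc b)) (2≤xᵇ⇒b⁻¹≤log b 2≤xᵇ) ⟩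
      log x * fromℕ (ℕ.suc b)               ≈⟨ *-congʳ 0≈log ⟨
      0# * fromℕ (ℕ.suc b)                  ≈⟨ zeroˡ _ ⟩
      0#                                    ∎))

  1≤log2 : 1# ≤ log 2#
  1≤log2 = proj₁ (log-isLUB 1≤2) (1 , 0 , *-identityˡ (fromℕ 1) , ≤-refl)

  -- It suffices that `log y` divided by `j` bounds the rationals defining `log x`. Such a rational
  -- a/b, scaled by `j`, is one of those defining `log y`: raising its inequality to the power `j`
  -- and exchanging exponents turns `x ^ j` into a base that is at most `y`.
  log-^-≤ : ∀ {x y} j → 1# ≤ x → 1# ≤ y → x ^ j ≤ y → fromℕ j * log x ≤ log y
  log-^-≤ {x} {y} ℕ.zero 1≤x 1≤y x^j≤y = ≤-respˡ-≈ (sym (zeroˡ (log x))) (log-nonneg 1≤y)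
  log-^-≤ {x} {y} (ℕ.suc j′) 1≤x 1≤y x^j≤y = begin
    fromℕ j * log x                   ≤⟨ *-monoʳ-≤ (fromℕ-nonneg j) log≤ ⟩
    fromℕ j * (fromℕ j ⁻¹ * log y)    ≈⟨ j[j⁻¹t]≈t (log y) ⟩
    log y                             ∎
    where
    j : ℕ
    j = ℕ.suc j′

    j[j⁻¹t]≈t : ∀ t → fromℕ j * (fromℕ j ⁻¹ * t) ≈ t
    j[j⁻¹t]≈t t = trans (sym (*-assoc _ _ t))
      (trans (*-congʳ (⁻¹-inverseʳ (proj₂ (0<fromℕ[1+n] j′) ∘ sym))) (*-identityˡ t))

    log≤ : log x ≤ fromℕ j ⁻¹ * log y
    log≤ = proj₂ (log-isLUB 1≤x) λ {r} (a , b′ , rb≈a , 2^a≤x^b) →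
      let b = ℕ.suc b′ in
      *-cancelˡ-≤ (0<fromℕ[1+n] j′) (begin
        -- The product `fromℕ j * r` is represented by the numerator `j ℕ.* a` over the unchanged
        -- denominator `b`.
        fromℕ j * r  ≤⟨ proj₁ (log-isLUB 1≤y) (j ℕ.* a , b′ ,
          trans (*-assoc (fromℕ j) r (fromℕ b)) (trans (*-congˡ rb≈a) (sym (×1-homo-* j a))) ,
          (begin
            2# ^ (j ℕ.* a)  ≈⟨ ^-congʳ 2# (ℕ.*-comm j a) ⟩
            2# ^ (a ℕ.* j)  ≈⟨ ^-assocʳ 2# a j ⟨
            (2# ^ a) ^ j    ≤⟨ ^-monoˡ-≤ j (^-nonneg a (fromℕ-nonneg 2)) 2^a≤x^b ⟩
            (x ^ b) ^ j     ≈⟨ ^-assocʳ x b j ⟩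
            x ^ (b ℕ.* j)   ≈⟨ ^-congʳ x (ℕ.*-comm b j) ⟩
            x ^ (j ℕ.* b)   ≈⟨ ^-assocʳ x j b ⟨
            (x ^ j) ^ b     ≤⟨ ^-monoˡ-≤ b (^-nonneg j (≤-trans 0≤1 1≤x)) x^j≤y ⟩
            y ^ b           ∎)) ⟩
        log y                           ≈⟨ j[j⁻¹t]≈t (log y) ⟨
        fromℕ j * (fromℕ j ⁻¹ * log y)  ∎)

  -- Finite sums

  sum-mono-≤ : ∀ {k} {f g : Fin k → Carrier} → (∀ j → f j ≤ g j) → sum f ≤ sum g
  sum-mono-≤ {ℕ.zero}  f≤g = ≤-refl
  sum-mono-≤ {ℕ.suc k} f≤g = +-mono-≤ (f≤g zero) (sum-mono-≤ (f≤g ∘ suc))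

  -- A gain of `a` at a single index survives in the total. This is how one update is seen to raise
  -- the total count over a cover by at least 1.
  sum-mono-≤-at : ∀ {k} {f g : Fin k → Carrier} {a} j₀ →
    (∀ j → f j ≤ g j) → f j₀ + a ≤ g j₀ → sum f + a ≤ sum g
  sum-mono-≤-at {f = f} {g} {a} zero f≤g f+a≤g = begin
    (f zero + sum (f ∘ suc)) + a  ≈⟨ solve 3 (λ x s a → (x :+ s) :+ a := (x :+ a) :+ s) refl (f zero) (sum (f ∘ suc)) a ⟩
    (f zero + a) + sum (f ∘ suc)  ≤⟨ +-mono-≤ f+a≤g (sum-mono-≤ (f≤g ∘ suc)) ⟩
    g zero + sum (g ∘ suc)        ∎
    where open Solver
  sum-mono-≤-at {f = f} {g} {a} (suc j₀) f≤g f+a≤g = begin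
    (f zero + sum (f ∘ suc)) + a  ≈⟨ +-assoc _ _ _ ⟩
    f zero + (sum (f ∘ suc) + a)  ≤⟨ +-mono-≤ (f≤g zero) (sum-mono-≤-at j₀ (f≤g ∘ suc) f+a≤g) ⟩
    g zero + sum (g ∘ suc)        ∎

  module _ {k p} {P : Pred (Fin k) p} (P? : Decidable P) where

    sumOver-mono-≤ : ∀ {f g : Fin k → Carrier} →
      (∀ j → f j ≤ g j) → sumOver P? f ≤ sumOver P? g
    sumOver-mono-≤ {f} {g} f≤g = sum-mono-≤ term
      where
      term : ∀ j → (if does (P? j) then f j else 0#) ≤ (if does (P? j) then g j else 0#)
      term j with does (P? j)
      ... | true  = f≤g j
      ... | false = ≤-refl

    sumOver-mono-≤-at : ∀ {f g : Fin k → Carrier} {a j₀} → P j₀ →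
      (∀ j → f j ≤ g j) → f j₀ + a ≤ g j₀ → sumOver P? f + a ≤ sumOver P? g
    sumOver-mono-≤-at {f} {g} {a} {j₀} Pj₀ f≤g f+a≤g = sum-mono-≤-at j₀ term term₀
      where
      term : ∀ j → (if does (P? j) then f j else 0#) ≤ (if does (P? j) then g j else 0#)
      term j with does (P? j)
      ... | true  = f≤g j
      ... | false = ≤-refl

      term₀ : (if does (P? j₀) then f j₀ else 0#) + a ≤ (if does (P? j₀) then g j₀ else 0#)
      term₀ with P? j₀
      ... | yes _   = f+a≤g
      ... | no ¬Pj₀ = contradiction Pj₀ ¬Pj₀

    -- The zero function lies below `f` and gains `f j₀` at the index `j₀`, so the previous bound
    -- applies with the zero sum as starting point.
    term≤sumOver : ∀ {f : Fin k → Carrier} {j₀} → P j₀ →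
      (∀ j → 0# ≤ f j) → f j₀ ≤ sumOver P? f
    term≤sumOver {f} {j₀} Pj₀ 0≤f = begin
      f j₀                    ≈⟨ +-identityˡ (f j₀) ⟨
      0# + f j₀               ≤⟨ +-monoˡ-≤ (f j₀) 0≤Σ0 ⟩
      sumOver P? (λ _ → 0#) + f j₀
        ≤⟨ sumOver-mono-≤-at Pj₀ 0≤f (≤-reflexive (+-identityˡ (f j₀))) ⟩
      sumOver P? f            ∎
      where
      0≤term : ∀ j → 0# ≤ (if does (P? j) then 0# else 0#)
      0≤term j with does (P? j)
      ... | true  = ≤-refl
      ... | false = ≤-refl

      0≤Σ0 : 0# ≤ sumOver P? (λ _ → 0#)
      0≤Σ0 = ≤-respˡ-≈ (sum-replicate-zero k) (sum-mono-≤ 0≤term)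

  sumOver-const : ∀ {k} (D : Subset k) x → sumOver (_∈? D) (λ _ → x) ≈ fromℕ ∣ D ∣ * x
  sumOver-const []            x = sym (zeroˡ x)
  sumOver-const (outside ∷ D) x = trans (+-identityˡ _) (sumOver-const D x)
  sumOver-const (inside ∷ D)  x = trans (+-cong (sym (*-identityˡ x)) (sumOver-const D x))
    (sym (distribʳ x 1# (fromℕ ∣ D ∣)))

-- Invariant of a run and the resulting competitive ratios

module OnlineSetCoverAnalysis {c ℓ} (ℝ : CompleteOrderedField c ℓ)
                              {n m : ℕ} (1≤n : 1 ℕ.≤ n) (1≤m : 1 ℕ.≤ m)
                              (S : Fin m → Subset n) where
  open CompleteOrderedField ℝ hiding (zero)
  open OrderedFieldProperties ℝ
  open SetCover S
  open OnlineSetCover ℝ S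
  open ≤-Reasoning

  module _ {θ : Carrier} (1<θ : 1# < θ) where
    private
      1≤θ : 1# ≤ θ
      1≤θ = proj₁ 1<θ

      0≤θ : 0# ≤ θ
      0≤θ = ≤-trans 0≤1 1≤θ

      1≤M : 1# ≤ fromℕ m
      1≤M = 1≤fromℕ 1≤m

      1≤θM : 1# ≤ θ * fromℕ m
      1≤θM = ≤-respˡ-≈ (*-identityˡ 1#) (*-mono-≤ 0≤θ 0≤1 1≤θ 1≤M)

      costBound : Carrier
      costBound = 2# * θ * log (fromℕ n)

      0≤costBound : 0# ≤ costBound
      0≤costBound = *-nonneg (*-nonneg (fromℕ-nonneg 2) 0≤θ) (log-nonneg (1≤fromℕ 1≤n))

    -- `count s` is the number of updates of elements of `S s` so far.
    record Invariant (D : Subset m) (st : State) : Set (c ⊔ ℓ) where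
      open State st
      field
        count          : Fin m → ℕ
        cost           : fromℕ ∣ selected ∣ ≤ costBound * sumOver (_∈? D) (fromℕ ∘ count)
        weight-growth  : ∀ s → θ ^ count s ≤ (θ * fromℕ m) * weight s
        weight-nonneg  : ∀ s → 0# ≤ weight s
        weight-bounded : ∀ s → weight s ≤ θ

    initial-invariant : ∀ D → Invariant D (initial θ)
    initial-invariant D = record
      { count          = λ _ → 0
      ; cost           = begin
          fromℕ ∣ State.selected (initial θ) ∣  ≡⟨ ≡.cong fromℕ (∣⊥∣≡0 m) ⟩
          0#                                    ≈⟨ zeroʳ costBound ⟨
          costBound * 0#                        ≈⟨ *-congˡ (trans (sumOver-const D 0#) (zeroʳ _)) ⟨
          costBound * sumOver (_∈? D) (λ _ → 0#)  ∎
      -- With all counts 0 the power of `θ` is 1, and the initial weight is exactly the inverse of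
      -- `θ * fromℕ m`.
      ; weight-growth  = λ _ → ≤-reflexive (sym θMw≈1)
      ; weight-nonneg  = λ _ → 0≤w
      ; weight-bounded = λ _ → begin
          w                     ≈⟨ *-identityˡ w ⟨
          1# * w                ≤⟨ *-monoˡ-≤ 0≤w 1≤θM ⟩
          (θ * fromℕ m) * w     ≈⟨ θMw≈1 ⟩
          1#                    ≤⟨ 1≤θ ⟩
          θ                     ∎
      }
      where
      w : Carrier
      w = (θ * fromℕ m) ⁻¹

      0≤w : 0# ≤ w
      0≤w = ⁻¹-nonneg (0<1≤x 1≤θM)

      θMw≈1 : (θ * fromℕ m) * w ≈ 1#
      θMw≈1 = ⁻¹-inverseʳ (proj₂ (0<1≤x 1≤θM) ∘ sym)

    -- The covering hypothesis supplies the set to charge: an update costs at most `costBound` and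
    -- raises the count of at least one member of `D` by 1.
    step-invariant : ∀ {D st i st′} → Covered D i → Step θ st i st′ →
      Invariant D st → Invariant D st′
    step-invariant covered (skip _) inv = inv
    -- The exponent 0 would leave the element weight unchanged, both below and above 1. Hence every
    -- real update has exponent at least 1.
    step-invariant _ (update ℕ.zero T wᵢ<1 1<θᵏwᵢ _ _ _ _ _) inv =
      contradiction (antisym (proj₁ wᵢ<1) (≤-respʳ-≈ (*-identityˡ _) (proj₁ 1<θᵏwᵢ))) (proj₂ wᵢ<1)
    step-invariant {D} {⟨ w , C ⟩} {i} (s₀ , s₀∈D , i∈Ss₀)
                   (update k@(ℕ.suc k′) T wᵢ<1 1<θᵏwᵢ k-minimal T⊆Sᵢ ∣T∣≤ _ _) inv = record
      { count          = count′
      ; cost           = begin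
          fromℕ ∣ C ∪ T ∣               ≤⟨ fromℕ-mono-≤ (∣p∪q∣≤∣p∣+∣q∣ C T) ⟩
          fromℕ (∣ C ∣ ℕ.+ ∣ T ∣)       ≈⟨ ×-homo-+ 1# ∣ C ∣ ∣ T ∣ ⟩
          fromℕ ∣ C ∣ + fromℕ ∣ T ∣     ≤⟨ +-mono-≤ cost ∣T∣≤ ⟩
          costBound * Σcount + costBound       ≈⟨ +-congˡ (*-identityʳ costBound) ⟨
          costBound * Σcount + costBound * 1#  ≈⟨ distribˡ costBound Σcount 1# ⟨
          costBound * (Σcount + 1#)            ≤⟨ *-monoʳ-≤ 0≤costBound Σcount+1≤Σcount′ ⟩
          costBound * sumOver (_∈? D) (fromℕ ∘ count′)  ∎
      ; weight-growth  = growth′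
      ; weight-nonneg  = nonneg′
      ; weight-bounded = bounded′
      }
      where
      open Invariant inv

      count′ : Fin m → ℕ
      count′ s = if does (i ∈? S s) then ℕ.suc (count s) else count s

      Σcount : Carrier
      Σcount = sumOver (_∈? D) (fromℕ ∘ count)

      count≤count′ : ∀ s → fromℕ (count s) ≤ fromℕ (count′ s)
      count≤count′ s with does (i ∈? S s)
      ... | true  = x≤1+x (fromℕ (count s))
      ... | false = ≤-refl

      count+1≤count′ : fromℕ (count s₀) + 1# ≤ fromℕ (count′ s₀)
      count+1≤count′ with i ∈? S s₀
      ... | yes _    = ≤-reflexive (+-comm _ _)
      ... | no i∉Ss₀ = contradiction i∈Ss₀ i∉Ss₀

      Σcount+1≤Σcount′ : Σcount + 1# ≤ sumOver (_∈? D) (fromℕ ∘ count′)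
      Σcount+1≤Σcount′ = sumOver-mono-≤-at (_∈? D) s₀∈D count≤count′ count+1≤count′

      -- If the exponent `k′`, one less than `k`, already pushed the weight above 1, minimality
      -- would give `k ≤ k′`.
      θᵏ′wᵢ≤1 : θ ^ k′ * elementWeight w i ≤ 1#
      θᵏ′wᵢ≤1 with θ ^ k′ * elementWeight w i ≤? 1#
      ... | yes p = p
      ... | no ¬p = contradiction
        (k-minimal k′ (≰⇒≥ ¬p , ¬p ∘ ≤-reflexive ∘ sym)) (ℕ.<-irrefl ≡.refl)

      growth′ : ∀ s → θ ^ count′ s ≤ (θ * fromℕ m) * augment θ k i w s
      growth′ s with does (i ∈? S s)
      ... | false = weight-growth s
      ... | true  = begin
        θ * θ ^ count s                    ≤⟨ *-mono-≤ (^-nonneg k 0≤θ) (^-nonneg (count s) 0≤θ) θ≤θᵏ (weight-growth s) ⟩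
        θ ^ k * ((θ * fromℕ m) * w s)      ≈⟨ solve 3 (λ x y z → x :* (y :* z) := y :* (x :* z)) refl (θ ^ k) (θ * fromℕ m) (w s) ⟩
        (θ * fromℕ m) * (θ ^ k * w s)      ∎
        where
        open Solver
        -- Since `k` is at least 1, the single factor `θ` gained by the count is matched by the
        -- factor `θ ^ k` gained by the weight.
        θ≤θᵏ : θ ≤ θ ^ k
        θ≤θᵏ = ≤-respˡ-≈ (*-identityʳ θ) (*-monoʳ-≤ 0≤θ (1≤x^n k′ 1≤θ))

      nonneg′ : ∀ s → 0# ≤ augment θ k i w s
      nonneg′ s with does (i ∈? S s)
      ... | true  = *-nonneg (^-nonneg k 0≤θ) (weight-nonneg s)
      ... | false = weight-nonneg s

      bounded′ : ∀ s → augment θ k i w s ≤ θ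
      bounded′ s with i ∈? S s
      ... | no _     = weight-bounded s
      ... | yes i∈Ss = begin
        -- Nonnegativity of the weights makes a single weight at most the weight of the element.
        -- Splitting off one factor `θ` then leaves a product that is at most 1.
        θ ^ k * w s                          ≤⟨ *-monoʳ-≤ (^-nonneg k 0≤θ) (term≤sumOver (λ s → i ∈? S s) i∈Ss weight-nonneg) ⟩
        θ ^ k * elementWeight w i            ≈⟨ *-assoc θ (θ ^ k′) _ ⟩
        θ * (θ ^ k′ * elementWeight w i)     ≤⟨ *-monoʳ-≤ 0≤θ θᵏ′wᵢ≤1 ⟩
        θ * 1#                               ≈⟨ *-identityʳ θ ⟩
        θ                                    ∎

    run-invariant : ∀ {D st σ st′} → CoversAll D σ → Run θ st σ st′ →
      Invariant D st → Invariant D st′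
    run-invariant covers []           inv = inv
    run-invariant covers (step ∷ run) inv =
      run-invariant (covers ∘ there) run (step-invariant (covers (here ≡.refl)) step inv)

    -- For `N` at least 2, two factors `θ` cancel and the rest is a power of `θ` bounded by `m`, to
    -- which the logarithm applies. For smaller `N` the term `2# * log θ` already suffices. Keeping
    -- `log θ` as a factor postpones the division.
    θ^N≤θ²m⇒N·logθ≤2logθ+logm : ∀ N → θ ^ N ≤ (θ * fromℕ m) * θ →
      fromℕ N * log θ ≤ 2# * log θ + log (fromℕ m)
    θ^N≤θ²m⇒N·logθ≤2logθ+logm (ℕ.suc (ℕ.suc N)) θᴺ≤ = begin
      fromℕ (2 ℕ.+ N) * log θ            ≈⟨ *-congʳ (×-homo-+ 1# 2 N) ⟩
      (2# + fromℕ N) * log θ             ≈⟨ distribʳ (log θ) 2# (fromℕ N) ⟩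
      2# * log θ + fromℕ N * log θ       ≤⟨ +-monoʳ-≤ _ (log-^-≤ N 1≤θ 1≤M θᴺ≤M) ⟩
      2# * log θ + log (fromℕ m)         ∎
      where
      open Solver
      0<θ : 0# < θ
      0<θ = 0<1≤x 1≤θ

      θᴺ≤M : θ ^ N ≤ fromℕ m
      θᴺ≤M = *-cancelˡ-≤ 0<θ (*-cancelˡ-≤ 0<θ (begin
        θ * (θ * θ ^ N)       ≤⟨ θᴺ≤ ⟩
        (θ * fromℕ m) * θ     ≈⟨ solve 2 (λ t M → (t :* M) :* t := t :* (t :* M)) refl θ (fromℕ m) ⟩
        θ * (θ * fromℕ m)     ∎))
    θ^N≤θ²m⇒N·logθ≤2logθ+logm 1 _ = begin
      fromℕ 1 * log θ             ≤⟨ *-monoˡ-≤ (log-nonneg 1≤θ) (fromℕ-mono-≤ {1} {2} (ℕ.s≤s ℕ.z≤n)) ⟩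
      2# * log θ                  ≈⟨ +-identityʳ _ ⟨
      2# * log θ + 0#             ≤⟨ +-monoʳ-≤ _ (log-nonneg 1≤M) ⟩
      2# * log θ + log (fromℕ m)  ∎
    θ^N≤θ²m⇒N·logθ≤2logθ+logm ℕ.zero _ = begin
      0# * log θ                  ≈⟨ zeroˡ _ ⟩
      0#                          ≤⟨ +-nonneg (*-nonneg (fromℕ-nonneg 2) (log-nonneg 1≤θ)) (log-nonneg 1≤M) ⟩
      2# * log θ + log (fromℕ m)  ∎

    -- `ρ` is any bound on the number of updates per set. Leaving it abstract serves both uses:
    -- exact division by `log θ` for general `θ`, and an estimate from `1≤log2` for the baseline.
    competitive-ratio : ∀ {ρ} →
      (∀ {x} → x * log θ ≤ 2# * log θ + log (fromℕ m) → x ≤ ρ) →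
      HasCompetitiveRatio (OSC-Alg θ) (costBound * ρ)
    competitive-ratio {ρ} x≤ρ σ C opt (w , run) ((D , covers , ∣D∣≡opt) , _) = begin
      fromℕ ∣ C ∣                                     ≤⟨ cost ⟩
      costBound * sumOver (_∈? D) (fromℕ ∘ count)     ≤⟨ *-monoʳ-≤ 0≤costBound (sumOver-mono-≤ (_∈? D) count≤ρ) ⟩
      costBound * sumOver (_∈? D) (λ _ → ρ)           ≈⟨ *-congˡ (sumOver-const D ρ) ⟩
      costBound * (fromℕ ∣ D ∣ * ρ)                   ≡⟨ ≡.cong (λ k → costBound * (fromℕ k * ρ)) ∣D∣≡opt ⟩
      costBound * (fromℕ opt * ρ)                     ≈⟨ solve 3 (λ b o r → b :* (o :* r) := (b :* r) :* o) refl costBound (fromℕ opt) ρ ⟩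
      costBound * ρ * fromℕ opt                       ∎
      where
      open Solver
      open Invariant (run-invariant covers run (initial-invariant D))

      count≤ρ : ∀ s → fromℕ (count s) ≤ ρ
      count≤ρ s = x≤ρ (θ^N≤θ²m⇒N·logθ≤2logθ+logm (count s)
        -- Growth and boundedness of the weight combine to a bound on `θ ^ count s` free of the
        -- weight.
        (≤-trans (weight-growth s) (*-monoʳ-≤ (≤-trans 0≤1 1≤θM) (weight-bounded s))))

    OSC-Alg-ratio : HasCompetitiveRatio (OSC-Alg θ) (costBound * (2# + log (fromℕ m) * log θ ⁻¹))
    OSC-Alg-ratio = competitive-ratio λ {x} xl≤ → *-cancelʳ-≤ (log-positive 1<θ) (begin
      x * l                   ≤⟨ xl≤ ⟩
      2# * l + lm             ≈⟨ +-congˡ (*-identityʳ lm) ⟨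
      2# * l + lm * 1#        ≈⟨ +-congˡ (*-congˡ (⁻¹-inverseˡ (proj₂ (log-positive 1<θ) ∘ sym))) ⟨
      2# * l + lm * (l ⁻¹ * l)  ≈⟨ solve 4 (λ t l M j → t :* l :+ M :* (j :* l) := (t :+ M :* j) :* l) refl 2# l lm (l ⁻¹) ⟩
      (2# + lm * l ⁻¹) * l    ∎)
      where
      open Solver
      l lm : Carrier
      l  = log θ
      lm = log (fromℕ m)

    DF*baselineRatio : DF θ * baselineRatio ≈ costBound * (2# + log (fromℕ m) * log θ ⁻¹)
    DF*baselineRatio = begin-equality
      θ * ((2# * l + lm) * I) * (4# * ln * (2# + lm))
        ≈⟨ *-congˡ (*-congʳ (*-congʳ (×1-homo-* 2 2))) ⟩
      θ * ((2# * l + lm) * I) * (2# * 2# * ln * (2# + lm))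
        -- The factor 1 is inserted to be rewritten as `l * J`: its `l` completes the denominator
        -- that `I` inverts, and `J` remains as the division by `log θ`.
        ≈⟨ *-identityʳ _ ⟨
      θ * ((2# * l + lm) * I) * (2# * 2# * ln * (2# + lm)) * 1#
        ≈⟨ *-congˡ lJ≈1 ⟨
      θ * ((2# * l + lm) * I) * (2# * 2# * ln * (2# + lm)) * (l * J)
        ≈⟨ solve 7 (λ θ 2l+lm I ln 2+lm l×J t →
             θ :* (2l+lm :* I) :* (t :* t :* ln :* 2+lm) :* l×J
             := (t :* θ :* ln) :* (2l+lm :* (t :* 2+lm :* l×J :* I)))
             refl θ (2# * l + lm) I ln (2# + lm) (l * J) 2# ⟩
      costBound * ((2# * l + lm) * (2# * (2# + lm) * (l * J) * I))
        ≈⟨ *-congˡ (solve 6 (λ t l M J I u →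
             (t :* l :+ M) :* (t :* u :* (l :* J) :* I)
             := (t :* (l :* J) :+ M :* J) :* ((t :* l :* u) :* I))
             refl 2# l lm J I (2# + lm)) ⟩
      costBound * ((2# * (l * J) + lm * J) * ((2# * l * (2# + lm)) * I))
        ≈⟨ *-congˡ (*-cong (+-congʳ (trans (*-congˡ lJ≈1) (*-identityʳ 2#))) (⁻¹-inverseʳ (proj₂ 0<den ∘ sym))) ⟩
      costBound * ((2# + lm * J) * 1#)
        ≈⟨ *-congˡ (*-identityʳ _) ⟩
      costBound * (2# + lm * J) ∎
      where
      open Solver
      l lm ln I J : Carrier
      l  = log θ
      lm = log (fromℕ m)
      ln = log (fromℕ n)
      I  = (2# * l * (2# + lm)) ⁻¹
      J  = l ⁻¹

      lJ≈1 : l * J ≈ 1#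
      lJ≈1 = ⁻¹-inverseʳ (proj₂ (log-positive 1<θ) ∘ sym)

      -- The last factor is at least 2 because `log (fromℕ m)` is nonnegative.
      0<den : 0# < 2# * l * (2# + lm)
      0<den = *-positive (*-positive (0<fromℕ[1+n] 1) (log-positive 1<θ))
        (0<1≤x (≤-trans 1≤2 (≤-respˡ-≈ (+-identityʳ 2#) (+-monoʳ-≤ 2# (log-nonneg 1≤M)))))

  -- The value of `log 2#` need not be computed: from `1≤log2`, `log (fromℕ m)` is at most its
  -- product with `log 2#`, and `log 2#` then cancels as a common factor. The constant 4 arises as 2
  -- times `θ`.
  baseline-ratio : HasCompetitiveRatio (OSC-Alg 2#) baselineRatio
  baseline-ratio σ C opt run isOpt = begin
    fromℕ ∣ C ∣                                            ≤⟨ ratio σ C opt run isOpt ⟩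
    2# * 2# * log (fromℕ n) * (2# + log (fromℕ m)) * fromℕ opt
      ≈⟨ *-congʳ (*-congʳ (*-congʳ (×1-homo-* 2 2))) ⟨
    baselineRatio * fromℕ opt                              ∎
    where
    1<2 : 1# < 2#
    1<2 = 1≤2 , λ 1≈2 → 0≉1 (antisym 0≤1 (+-cancelʳ-≤ 1# (begin
      1# + 1#         ≈⟨ +-congˡ (+-identityʳ 1#) ⟨
      2#              ≈⟨ 1≈2 ⟨
      1#              ≈⟨ +-identityˡ 1# ⟨
      0# + 1#         ∎)))

    ratio : HasCompetitiveRatio (OSC-Alg 2#) (2# * 2# * log (fromℕ n) * (2# + log (fromℕ m)))
    ratio = competitive-ratio 1<2 λ {x} xl≤ → *-cancelʳ-≤ (0<1≤x 1≤log2) (begin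
      x * log 2#                                 ≤⟨ xl≤ ⟩
      2# * log 2# + log (fromℕ m)                ≈⟨ +-congˡ (*-identityʳ _) ⟨
      2# * log 2# + log (fromℕ m) * 1#           ≤⟨ +-monoʳ-≤ _ (*-monoʳ-≤ (log-nonneg (1≤fromℕ 1≤m)) 1≤log2) ⟩
      2# * log 2# + log (fromℕ m) * log 2#       ≈⟨ distribʳ _ _ _ ⟨
      (2# + log (fromℕ m)) * log 2#              ∎)

theorem4p1 : ∀ {c ℓ} (ℝ : CompleteOrderedField c ℓ) →
    let open CompleteOrderedField ℝ in
    (n m : ℕ) → 2 ℕ.≤ n →
    (S : Fin m → Subset n) → (∀ i → ∃ λ s → i ∈ S s) →
    (θ : Carrier) → 1# < θ →
    let open OnlineSetCover ℝ S in
    IsDegradationFactor (DF θ) (OSC-Alg θ) (OSC-Alg 2#) baselineRatio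
    × DF θ * baselineRatio
        ≈ (2# * θ * log (fromℕ n)) * (2# + log (fromℕ m) * log θ ⁻¹)
theorem4p1 ℝ n m 2≤n S cover θ 1<θ =
  (baseline-ratio , λ σ C opt run isOpt →
    ≤-respʳ-≈ (*-congʳ (sym (DF*baselineRatio 1<θ))) (OSC-Alg-ratio 1<θ σ C opt run isOpt)) ,
  DF*baselineRatio 1<θ
  where
  open CompleteOrderedField ℝ using (*-congʳ; sym)
  open OrderedFieldProperties ℝ using (≤-respʳ-≈)

  1≤n : 1 ℕ.≤ n
  1≤n = ℕ.<⇒≤ 2≤n

  -- The ground set has an element, and the index of a set containing it lies in `Fin m`.
  1≤m : 1 ℕ.≤ m
  1≤m = ℕ.≤-trans (ℕ.s≤s ℕ.z≤n) (Fin.toℕ<n (proj₁ (cover (fromℕ< 1≤n))))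

  open OnlineSetCoverAnalysis ℝ 1≤n 1≤m S
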